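{- The set of permutations obtained as products of transpositions associated to a partial filling of the shifted staircase shape $\Delta_n$ is exactly $\mathcal{L}_n$, the set of left-unimodal permutations in $\mathcal{S}_n$.
   Context: A permutation $\pi\in\mathcal{S}_n$ is left-unimodal if for every $1\le j\le n$ the set $\{\pi(1),\dots,\pi(j)\}$ is an interval in $\mathbb{Z}$, i.e. of the form $\{a,a+1,\dots,b\}$; $\mathcal{L}_n$ is the set of left-unimodal permutations in $\mathcal{S}_n$. The shifted staircase shape $\Delta_n$ is the set of boxes $(i,j)$ with $1\le i<j\le n$, where $i$ is the row label (rows labeled $1,\dots,n-1$ from top to bottom) and $j$ is the column label (columns labeled $2,\dots,n$ from left to right). Take a filling of $\Delta_n$ with the numbers $1,\dots,n(n-1)/2$, each used once, with entries increasing along rows (left to right) and columns (top to bottom), and erase the numbers greater than $k$ for some $0\le k\le n(n-1)/2$; the result is called a partial filling of $\Delta_n$. For each remaining entry $1\le r\le k$ lying in row $i$ and column $j$, let $t_r$ be the transposition $(i,j)$. The permutation associated to the partial filling is $\pi=t_1t_2\cdots t_k$, where the product is computed left to right: $\pi(x)$ is obtained by applying $t_1$ to $x$ first, then $t_2$, and so on, finally $t_k$ (so for example $(1,2)(1,3)$ is the permutation $231$ in one-line notation, and $(1,2)(1,3)(1,4)(2,3)(2,4)(1,5)(3,4)(1,6)(2,5)(2,6)=4356217$). For $k=0$ the permutation is the identity. -}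

module Defs where

open import Data.Fin.Base as Fin using (Fin; toℕ; inject≤)
open import Data.Fin.Permutation using (Permutation′; _⟨$⟩ʳ_; _≈_)
open import Data.Fin.Permutation.Transposition.List using (eval)
open import Data.Integer.Base as ℤ using (ℤ; +_)
open import Data.List.Base using (tabulate)
open import Data.Nat.Base as ℕ using (ℕ; suc; _*_; _∸_)
open import Data.Nat.DivMod using (_/_)
open import Data.Product.Base using (∃; ∃-syntax; ∃₂; _×_; _,_)
open import Function.Bundles using (_↔_; Inverse)
open import Level using (0ℓ)
open import Relation.Binary.PropositionalEquality.Core using (_≡_)
open import Relation.Unary using (Pred; _≐_)

-- The paper's labels 1, …, n are the elements of Fin n, so a label x is
-- represented by the element with toℕ equal to x ∸ 1.
label : ∀ {n} → Fin n → ℤ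
label x = + suc (toℕ x)

IsInterval : Pred ℤ 0ℓ → Set
IsInterval P = ∃₂ λ a b → P ≐ (λ z → a ℤ.≤ z × z ℤ.≤ b)

-- prefix π j is { π(1), …, π(j) } as a subset of ℤ.
prefix : ∀ {n} → Permutation′ n → Fin n → Pred ℤ 0ℓ
prefix π j z = ∃[ i ] i Fin.≤ j × label (π ⟨$⟩ʳ i) ≡ z

LeftUnimodal : ∀ n → Pred (Permutation′ n) 0ℓ
LeftUnimodal n π = ∀ (j : Fin n) → IsInterval (prefix π j)

-- The boxes of the shifted staircase Δₙ. The inequality is irrelevant so
-- that a box is determined by its row and its column.
record Box (n : ℕ) : Set where
  constructor box
  field
    row col  : Fin n
    .row<col : row Fin.< col

open Box public using (row; col)

size : ℕ → ℕ
size n = n * (n ∸ 1) / 2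

-- The number r of a filling is represented by the element of Fin (size n)
-- with toℕ equal to r ∸ 1.
record Filling (n : ℕ) : Set where
  field
    entries : Box n ↔ Fin (size n)

  entry : Box n → Fin (size n)
  entry = Inverse.to entries

  boxOf : Fin (size n) → Box n
  boxOf = Inverse.from entries

  field
    rows-increasing    : ∀ b c → row b ≡ row c → col b Fin.< col c →
                         entry b Fin.< entry c
    columns-increasing : ∀ b c → col b ≡ col c → row b Fin.< row c →
                         entry b Fin.< entry c

-- The filling obtained by erasing the numbers greater than k. Only the boxes
-- of the numbers 1, …, k are used below; different fillings may represent the
-- same partial filling.
record PartialFilling (n : ℕ) : Set where
  field
    filling : Filling n
    k       : ℕ
    k≤size  : k ℕ.≤ size n

  remainingBox : Fin k → Box n
  remainingBox r = Filling.boxOf filling (inject≤ r k≤size)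

-- t₁ t₂ ⋯ t_k. The function eval applies the transpositions of the list from
-- left to right: the head of the list acts first.
associatedPermutation : ∀ {n} → PartialFilling n → Permutation′ n
associatedPermutation T = eval (tabulate λ r → row (remainingBox r) , col (remainingBox r))
  where open PartialFilling T

FromPartialFilling : ∀ n → Pred (Permutation′ n) 0ℓ
FromPartialFilling n π = ∃ λ (T : PartialFilling n) → associatedPermutation T ≈ π

{-# OPTIONS --safe #-}
module Submission where

-- Record a partial filling by the numbers d p of its boxes on the diagonals
-- j − i = p, of which it always contains the topmost ones. Its permutation maps
-- the first p positions onto the values 1 + d p, …, d p + p. Indeed, let a
-- new box (i , j) be added on the diagonal p. For q < p both i and j lie outside
-- the window of q, for q > p both lie inside, and for q = p the window changes
-- from i, …, j − 1 to i + 1, …, j, which is what exchanging the values i and j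
-- does. Conversely, the windows of a left-unimodal permutation are nested, which
-- says that the boxes with i ≤ d (j − i) are closed under moving up or left;
-- listing these boxes first, then the others, each row by row, gives a filling.

open import Defs
open import Data.Fin.Base as Fin using (Fin; zero; suc; toℕ; fromℕ<; inject≤; cast)
open import Data.Fin.Permutation
  using (Permutation′; _⟨$⟩ʳ_; _⟨$⟩ˡ_; _≈_; _∘ₚ_; transpose; inverseˡ; inverseʳ; flip)
  renaming (id to idₚ)
open import Data.Fin.Permutation.Transposition.List using (eval)
open import Data.Fin.Properties as Fin
  using (toℕ<n; toℕ-fromℕ<; toℕ-injective; toℕ-cast; toℕ-inject≤; fromℕ<-injective;
         cast-involutive; injective⇒≤)
open import Data.Integer.Base as ℤ using (+≤+)
open import Data.Integer.Properties as ℤ using (+-injective)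
open import Data.List.Base using (List; []; _∷_; _++_; length; lookup; map; filter; tabulate)
open import Data.List.Membership.Propositional using (_∈_)
open import Data.List.Membership.Propositional.Properties
  using (∈-++⁺ˡ; ∈-++⁺ʳ; ∈-map⁺; ∈-tabulate⁺; ∈-filter⁺; ∈-lookup)
open import Data.List.Properties using (length-++; length-++-≤ˡ; length-map; length-tabulate; partition-defn)
import Data.List.Relation.Binary.Permutation.Setoid.Properties as SetoidPermutation
open import Data.List.Relation.Unary.All as All using (All; []; _∷_)
import Data.List.Relation.Unary.All.Properties as All
open import Data.List.Relation.Unary.AllPairs as AllPairs using (AllPairs; []; _∷_)
import Data.List.Relation.Unary.AllPairs.Properties as AllPairs
open import Data.List.Relation.Unary.Any using (here; there; index)
open import Data.List.Relation.Unary.Any.Properties using (lookup-index)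
open import Data.Nat.Base using (ℕ; zero; suc; _+_; _*_; _∸_; _≤_; _<_; z≤n; s≤s; s≤s⁻¹; z<s)
open import Data.Nat.DivMod using (_/_; +-distrib-/-∣ˡ; m*n/n≡m)
open import Data.Nat.Divisibility using (divides-refl)
open import Data.Nat.Properties
open import Data.Nat.Solver using (module +-*-Solver)
open import Data.Product.Base using (∃; _×_; _,_; proj₁; proj₂)
open import Data.Sum.Base using (_⊎_; inj₁; inj₂)
open import Function.Base using (_∘_)
open import Function.Bundles using (_⇔_; mk⇔; Equivalence; Inverse; mk↔ₛ′)
open import Relation.Binary.Core using (Rel)
open import Relation.Binary.Definitions using (tri<; tri≈; tri>)
open import Relation.Binary.PropositionalEquality
open import Relation.Nullary using (¬_; yes; no; contradiction)
open import Relation.Nullary.Decidable using (recompute)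
open import Relation.Unary using (Pred; Decidable; ∁; _≐_)
open import Relation.Unary.Properties using (∁?)
open Equivalence using (to; from)

-- Rows and columns are counted from 0 from here on, so the window of length p
-- after the first a values is a, …, a + p − 1.
Window : ℕ → ℕ → ℕ → Set
Window a m v = a ≤ v × v < a + m

-- Equivalently, `d p` is at most `n ∸ p`, the number of boxes on the diagonal `p`.
Fits : ℕ → (ℕ → ℕ) → Set
Fits n d = ∀ p → 0 < p → p ≤ n → d p + p ≤ n

-- Windows and diagonal counts

module _ {n : ℕ} where

  row<col : (b : Box n) → toℕ (row b) < toℕ (col b)
  row<col (box i j i<j) = recompute (_ <? _) i<j

  diagonalBox : ∀ i {p} → 0 < p → i + p < n →
                ∃ λ (b : Box n) → toℕ (row b) ≡ i × toℕ (col b) ≡ i + p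
  diagonalBox i {p} 0<p i+p<n =
    box (fromℕ< i<n) (fromℕ< i+p<n)
        (subst₂ _<_ (sym (toℕ-fromℕ< i<n)) (sym (toℕ-fromℕ< i+p<n)) i<i+p)
    , toℕ-fromℕ< i<n , toℕ-fromℕ< i+p<n
    where
    i<i+p : i < i + p
    i<i+p = m<m+n i 0<p
    i<n : i < n
    i<n = <-trans i<i+p i+p<n

  -- Describing the preimage of each window makes the condition checkable one position at a time.
  Windows : (ℕ → ℕ) → Permutation′ n → Set
  Windows d π = ∀ p → 0 < p → p ≤ n → ∀ x →
                toℕ x < p ⇔ Window (d p) p (toℕ (π ⟨$⟩ʳ x))

  -- Counting is avoided: the remaining boxes of a diagonal are its topmost ones, so their number is
  -- the row at which they stop.
  DiagonalCounts : Filling n → ℕ → (ℕ → ℕ) → Set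
  DiagonalCounts F k d = ∀ b p → toℕ (row b) + p ≡ toℕ (col b) →
                         toℕ (Filling.entry F b) < k ⇔ toℕ (row b) < d p

  -- If `e p < d p`, the box of the diagonal `p` in row `e p` exists because `d` fits, and `d` and
  -- `e` disagree about it. Applied both ways, this makes the counts unique.
  diagonalCounts-≤ : ∀ F k {d e} → Fits n d → DiagonalCounts F k d → DiagonalCounts F k e →
                     ∀ p → 0 < p → p ≤ n → d p ≤ e p
  diagonalCounts-≤ _ _ {d} {e} fits D E p 0<p p≤n = ≮⇒≥ λ e<d →
    let b , rb , cb = diagonalBox (e p) 0<p (<-≤-trans (+-monoˡ-< p e<d) (fits p 0<p p≤n))
        diag = trans (cong (_+ p) rb) (sym cb)
    in <-irrefl rb (to (E b p diag) (from (D b p diag) (subst (_< d p) (sym rb) e<d)))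

  -- Let `π` take at `y` the value that `ρ` takes at `x`. Equal windows put `x` and `y` into the
  -- same prefixes, and the prefixes ending at `x` and at `y` then force `x` and `y` to agree.
  windows-determine : ∀ {d e} π ρ → Windows d π → Windows e ρ →
                      (∀ p → 0 < p → p ≤ n → d p ≡ e p) → π ≈ ρ
  windows-determine {d} {e} π ρ W V d≡e x = trans (cong (π ⟨$⟩ʳ_) (toℕ-injective (sym y≡x))) πy
    where
    y = π ⟨$⟩ˡ (ρ ⟨$⟩ʳ x)
    πy : π ⟨$⟩ʳ y ≡ ρ ⟨$⟩ʳ x
    πy = inverseʳ π
    same : ∀ p → 0 < p → p ≤ n → toℕ x < p ⇔ toℕ y < p
    same p 0<p p≤n = mk⇔
      (λ x<p → from (W p 0<p p≤n y)
                 (subst₂ (λ a v → Window a p (toℕ v)) (sym (d≡e p 0<p p≤n)) (sym πy)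
                         (to (V p 0<p p≤n x) x<p)))
      (λ y<p → from (V p 0<p p≤n x)
                 (subst₂ (λ a v → Window a p (toℕ v)) (d≡e p 0<p p≤n) πy
                         (to (W p 0<p p≤n y) y<p)))
    y≡x : toℕ y ≡ toℕ x
    y≡x = ≤-antisym (s≤s⁻¹ (to (same _ z<s (toℕ<n x)) ≤-refl)) (s≤s⁻¹ (from (same _ z<s (toℕ<n y)) ≤-refl))

  windows⇒leftUnimodal : ∀ {d} π → Fits n d → Windows d π → LeftUnimodal n π
  -- Labels exceed the values counted from 0 by one, which moves the lower end up and makes the
  -- upper end inclusive.
  windows⇒leftUnimodal {d} π fits W j = ℤ.+ suc (d p) , ℤ.+ (d p + p) , ⊆ , ⊇
    where
    p = suc (toℕ j)
    ⊆ : ∀ {z} → prefix π j z → (ℤ.+ suc (d p) ℤ.≤ z) × (z ℤ.≤ ℤ.+ (d p + p))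
    ⊆ (i , i≤j , refl) =
      let a≤v , v<b = to (W p z<s (toℕ<n j) i) (s≤s i≤j) in +≤+ (s≤s a≤v) , +≤+ v<b
    ⊇ : ∀ {z} → (ℤ.+ suc (d p) ℤ.≤ z) × (z ℤ.≤ ℤ.+ (d p + p)) → prefix π j z
    -- The positive lower bound forces `z` to be the label of some `v`, and `fits` makes `v` a value
    -- of `π`.
    ⊇ (+≤+ (s≤s {n = v} a≤v) , +≤+ v<b) =
      i , s≤s⁻¹ (from (W p z<s (toℕ<n j) i) (subst (Window (d p) p) (sym πi) (a≤v , v<b)))
        , cong (ℤ.+_ ∘ suc) πi
      where
      v<n : v < n
      v<n = <-≤-trans v<b (fits p z<s (toℕ<n j))
      i = π ⟨$⟩ˡ fromℕ< v<n
      πi : toℕ (π ⟨$⟩ʳ i) ≡ v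
      πi = trans (cong toℕ (inverseʳ π)) (toℕ-fromℕ< v<n)

-- Adding the boxes of a filling one at a time

transpose-cases : ∀ {n} (i j v : Fin n) → let t = transpose i j ⟨$⟩ʳ v in
                  (v ≡ i × t ≡ j) ⊎ (v ≡ j × t ≡ i) ⊎ (v ≢ i × v ≢ j × t ≡ v)
transpose-cases i j v with v Fin.≟ i
... | yes v≡i = inj₁ (v≡i , refl)
... | no v≢i with v Fin.≟ j
...   | yes v≡j = inj₂ (inj₁ (v≡j , refl))
...   | no v≢j = inj₂ (inj₂ (v≢i , v≢j , refl))

override : (d : ℕ → ℕ) (p v : ℕ) → ∃ λ e → e p ≡ v × (∀ q → q ≢ p → e q ≡ d q)
override d p v = e , e-same , e-other
  where
  e : ℕ → ℕ
  e q with q ≟ p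
  ... | yes _ = v
  ... | no _  = d q
  e-same : e p ≡ v
  e-same with p ≟ p
  ... | yes _  = refl
  ... | no p≢p = contradiction refl p≢p
  e-other : ∀ q → q ≢ p → e q ≡ d q
  e-other q q≢p with q ≟ p
  ... | yes q≡p = contradiction q≡p q≢p
  ... | no _    = refl

module _ {n : ℕ} (F : Filling n) where
  open Filling F

  entry-<ʳ : ∀ {b c} → toℕ (row b) ≡ toℕ (row c) → toℕ (col b) < toℕ (col c) →
             toℕ (entry b) < toℕ (entry c)
  entry-<ʳ = rows-increasing _ _ ∘ toℕ-injective

  entry-<ᶜ : ∀ {b c} → toℕ (col b) ≡ toℕ (col c) → toℕ (row b) < toℕ (row c) →
             toℕ (entry b) < toℕ (entry c)
  entry-<ᶜ = columns-increasing _ _ ∘ toℕ-injective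

  module NextBox {d : ℕ → ℕ} {π : Permutation′ n} (r : Fin (size n))
                 (fits : Fits n d) (counts : DiagonalCounts F (toℕ r) d) (windows : Windows d π) where

    b : Box n
    b = boxOf r

    i j p : ℕ
    i = toℕ (row b)
    j = toℕ (col b)
    p = j ∸ i

    entry-b : toℕ (entry b) ≡ toℕ r
    entry-b = cong toℕ (Inverse.inverseˡ entries refl)

    entry≡r⇒≡b : ∀ {c} → toℕ (entry c) ≡ toℕ r → c ≡ b
    entry≡r⇒≡b c≡r = trans (sym (Inverse.inverseʳ entries refl)) (cong boxOf (toℕ-injective c≡r))

    i+p≡j : i + p ≡ j
    i+p≡j = m+[n∸m]≡n (<⇒≤ (row<col b))

    j<n : j < n
    j<n = toℕ<n (col b)

    0<p : 0 < p
    0<p = m<n⇒0<n∸m (row<col b)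

    -- The box `b` is not yet counted, so `d p ≤ i`. Were `d p < i`, the first uncounted box of the
    -- diagonal would lie up and left of `b`, hence carry a smaller number and be counted.
    dp≡i : d p ≡ i
    dp≡i = ≤-antisym
      (≮⇒≥ λ i<dp → <-irrefl entry-b (from (counts b p i+p≡j) i<dp))
      (≮⇒≥ λ dp<i →
        let dp+p<j = <-≤-trans (+-monoˡ-< p dp<i) (≤-reflexive i+p≡j)
            c , rc , cc = diagonalBox (d p) 0<p (<-trans dp+p<j j<n)
            c-row<col-b = <-trans (subst (_< i) (sym rc) dp<i) (row<col b)
            -- Entries are compared only along rows and columns, so the path from `c` to `b` turns
            -- at this corner.
            m = box (row c) (col b) c-row<col-b
            c<m = entry-<ʳ {c} {m} refl (subst (_< j) (sym cc) dp+p<j)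
            m<b = entry-<ᶜ {m} {b} refl (subst (_< i) (sym rc) dp<i)
        in <-irrefl rc (to (counts c p (trans (cong (_+ p) rc) (sym cc)))
                           (<-≤-trans (<-trans c<m m<b) (≤-reflexive entry-b))))

    module Inner {q} (0<q : 0 < q) (q<p : q < p) where

      -- The box of the diagonal `q` in row `i` stands left of `b`, so it is already there.
      i<dq : i < d q
      i<dq =
        let i+q<j = <-≤-trans (+-monoʳ-< i q<p) (≤-reflexive i+p≡j)
            c , rc , cc = diagonalBox i 0<q (<-trans i+q<j j<n)
            c<b = entry-<ʳ {c} {b} rc (subst (_< j) (sym cc) i+q<j)
        in subst (_< d q) rc (to (counts c q (trans (cong (_+ q) rc) (sym cc)))
                                 (<-≤-trans c<b (≤-reflexive entry-b)))

      -- The box of the diagonal `q` in column `j` stands below `b`, so it is still missing.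
      dq+q≤j : d q + q ≤ j
      dq+q≤j = ≮⇒≥ λ j<dq+q →
        let o+q≡j = m∸n+n≡m (<⇒≤ (<-≤-trans q<p (≤-trans (m≤n+m p i) (≤-reflexive i+p≡j))))
            o = j ∸ q
            c , rc , cc = diagonalBox o 0<q (subst (_< n) (sym o+q≡j) j<n)
            o<dq = +-cancelʳ-< q o (d q) (subst (_< d q + q) (sym o+q≡j) j<dq+q)
            i<o = +-cancelʳ-< q i o (subst (i + q <_) (trans i+p≡j (sym o+q≡j)) (+-monoʳ-< i q<p))
            b<c = entry-<ᶜ {b} {c} (sym (trans cc o+q≡j)) (subst (i <_) (sym rc) i<o)
            c<r = from (counts c q (trans (cong (_+ q) rc) (sym cc))) (subst (_< d q) (sym rc) o<dq)
        in <-asym c<r (subst (_< toℕ (entry c)) entry-b b<c)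

    module Outer {q} (p<q : p < q) (q≤n : q ≤ n) where

      0<q : 0 < q
      0<q = <-trans 0<p p<q

      -- A box of the diagonal `q` in row `i` would stand right of `b` and still be missing. The
      -- contrary assumption, with `fits`, ensures that this box exists.
      dq≤i : d q ≤ i
      dq≤i = ≮⇒≥ λ i<dq →
        let i+q<n = <-≤-trans (+-monoˡ-< q i<dq) (fits q 0<q q≤n)
            c , rc , cc = diagonalBox i 0<q i+q<n
            j<i+q = subst (_< i + q) i+p≡j (+-monoʳ-< i p<q)
            b<c = entry-<ʳ {b} {c} (sym rc) (subst (j <_) (sym cc) j<i+q)
            c<r = from (counts c q (trans (cong (_+ q) rc) (sym cc))) (subst (_< d q) (sym rc) i<dq)
        in <-asym c<r (subst (_< toℕ (entry c)) entry-b b<c)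

      -- A box of the diagonal `q` in column `j` would stand above `b` and already be there. It
      -- exists under the contrary assumption, which gives `q ≤ j`.
      j<dq+q : j < d q + q
      j<dq+q = ≰⇒> λ dq+q≤j →
        let o+q≡j = m∸n+n≡m (≤-trans (m≤n+m q (d q)) dq+q≤j)
            o = j ∸ q
            c , rc , cc = diagonalBox o 0<q (subst (_< n) (sym o+q≡j) j<n)
            dq≤o = +-cancelʳ-≤ q (d q) o (subst (d q + q ≤_) (sym o+q≡j) dq+q≤j)
            o<i = +-cancelʳ-< p o i (subst (o + p <_) (trans o+q≡j (sym i+p≡j)) (+-monoʳ-< o p<q))
            c<b = entry-<ᶜ {c} {b} (trans cc o+q≡j) (subst (_< i) (sym rc) o<i)
            o<dq = to (counts c q (trans (cong (_+ q) rc) (sym cc))) (<-≤-trans c<b (≤-reflexive entry-b))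
        in <⇒≱ (subst (_< d q) rc o<dq) dq≤o

    module _ {e : ℕ → ℕ} (e-same : e p ≡ suc i) (e-other : ∀ q → q ≢ p → e q ≡ d q) where

      fits′ : Fits n e
      fits′ q 0<q q≤n with q ≟ p
      ... | yes refl = subst (λ a → a + p ≤ n) (sym e-same) (subst (_< n) (sym i+p≡j) j<n)
      ... | no q≢p = subst (λ a → a + q ≤ n) (sym (e-other q q≢p)) (fits q 0<q q≤n)

      -- The only box with the number `r` is `b`, so just the threshold of its diagonal moves, from
      -- `i` to `suc i`.
      counts′ : DiagonalCounts F (suc (toℕ r)) e
      counts′ c q diag with q ≟ p
      ... | yes refl = mk⇔ (subst (toℕ (row c) <_) (sym e-same) ∘ s≤s ∘ ⇒)
                           (⇐ ∘ s≤s⁻¹ ∘ subst (toℕ (row c) <_) e-same)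
        where
        ⇒ : toℕ (entry c) < suc (toℕ r) → toℕ (row c) ≤ i
        ⇒ c≤r with m≤n⇒m<n∨m≡n (s≤s⁻¹ c≤r)
        ... | inj₁ c<r = <⇒≤ (subst (toℕ (row c) <_) dp≡i (to (counts c p diag) c<r))
        ... | inj₂ c≡r = ≤-reflexive (cong (toℕ ∘ row) (entry≡r⇒≡b c≡r))
        ⇐ : toℕ (row c) ≤ i → toℕ (entry c) < suc (toℕ r)
        ⇐ c≤i with m≤n⇒m<n∨m≡n c≤i
        ... | inj₁ c<i = m<n⇒m<1+n (from (counts c p diag) (subst (toℕ (row c) <_) (sym dp≡i) c<i))
        ... | inj₂ c≡i = s≤s (≤-reflexive (trans (cong (toℕ ∘ entry) c≡b) entry-b))
          where
          c≡b : c ≡ b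
          c≡b = cong₂-box (toℕ-injective c≡i)
                          (toℕ-injective (trans (sym diag) (trans (cong (_+ p) c≡i) i+p≡j)))
            where
            cong₂-box : ∀ {a c : Box n} → row a ≡ row c → col a ≡ col c → a ≡ c
            -- The third field is irrelevant, so eta identifies the two boxes.
            cong₂-box refl refl = refl
      ... | no q≢p = mk⇔ (subst (toℕ (row c) <_) (sym (e-other q q≢p)) ∘ to (counts c q diag) ∘ ⇒)
                         (m<n⇒m<1+n ∘ from (counts c q diag) ∘ subst (toℕ (row c) <_) (e-other q q≢p))
        where
        ⇒ : toℕ (entry c) < suc (toℕ r) → toℕ (entry c) < toℕ r
        ⇒ c≤r = ≤∧≢⇒< (s≤s⁻¹ c≤r) λ c≡r →
          q≢p (+-cancelˡ-≡ i q p
            (trans (subst (λ x → toℕ (row x) + q ≡ toℕ (col x)) (entry≡r⇒≡b c≡r) diag) (sym i+p≡j)))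

      -- The transposition acts after `π`, so positions stay fixed and it suffices to follow one
      -- value `v` through the exchange.
      windows′ : Windows e (π ∘ₚ transpose (row b) (col b))
      windows′ q 0<q q≤n x = mk⇔
        (to step ∘ to (windows q 0<q q≤n x)) (from (windows q 0<q q≤n x) ∘ from step)
        where
        v t : Fin n
        v = π ⟨$⟩ʳ x
        t = transpose (row b) (col b) ⟨$⟩ʳ v

        -- Abstracting `v` and `t` from their definitions lets the equations of each case be matched
        -- with `refl`.
        moved : ∀ {v t} → (v ≡ row b × t ≡ col b) ⊎ (v ≡ col b × t ≡ row b) ⊎
                          (v ≢ row b × v ≢ col b × t ≡ v) →
                Window (d q) q (toℕ v) ⇔ Window (e q) q (toℕ t)
        moved cases with <-cmp q p
        moved (inj₁ (refl , refl)) | tri< q<p q≢p _ rewrite e-other q q≢p =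
          mk⇔ (λ w → contradiction (proj₁ w) (<⇒≱ i<dq)) (λ w → contradiction (proj₂ w) (≤⇒≯ dq+q≤j))
          where open Inner 0<q q<p
        moved (inj₂ (inj₁ (refl , refl))) | tri< q<p q≢p _ rewrite e-other q q≢p =
          mk⇔ (λ w → contradiction (proj₂ w) (≤⇒≯ dq+q≤j)) (λ w → contradiction (proj₁ w) (<⇒≱ i<dq))
          where open Inner 0<q q<p
        moved (inj₁ (refl , refl)) | tri> _ q≢p p<q rewrite e-other q q≢p =
          mk⇔ (λ _ → ≤-trans dq≤i (<⇒≤ (row<col b)) , j<dq+q) (λ _ → dq≤i , <-trans (row<col b) j<dq+q)
          where open Outer p<q q≤n
        moved (inj₂ (inj₁ (refl , refl))) | tri> _ q≢p p<q rewrite e-other q q≢p =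
          mk⇔ (λ _ → dq≤i , <-trans (row<col b) j<dq+q) (λ _ → ≤-trans dq≤i (<⇒≤ (row<col b)) , j<dq+q)
          where open Outer p<q q≤n
        moved (inj₂ (inj₂ (_ , _ , refl))) | tri< _ q≢p _ rewrite e-other q q≢p = mk⇔ (λ w → w) (λ w → w)
        moved (inj₂ (inj₂ (_ , _ , refl))) | tri> _ q≢p _ rewrite e-other q q≢p = mk⇔ (λ w → w) (λ w → w)
        -- On the diagonal of `b`, the old window contains `i` but not `j`, the new one `j` but not
        -- `i`; all other values are in both or in neither.
        moved (inj₁ (refl , refl)) | tri≈ _ refl _ rewrite e-same | dp≡i | i+p≡j =
          mk⇔ (λ _ → row<col b , ≤-refl) (λ _ → ≤-refl , row<col b)
        moved (inj₂ (inj₁ (refl , refl))) | tri≈ _ refl _ rewrite e-same | dp≡i | i+p≡j =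
          mk⇔ (λ w → contradiction (proj₂ w) (<-irrefl refl)) (λ w → contradiction (proj₁ w) (<-irrefl refl))
        moved (inj₂ (inj₂ (v≢i , v≢j , refl))) | tri≈ _ refl _ rewrite e-same | dp≡i | i+p≡j =
          mk⇔ (λ w → ≤∧≢⇒< (proj₁ w) (v≢i ∘ toℕ-injective ∘ sym) , m<n⇒m<1+n (proj₂ w))
              (λ w → <⇒≤ (proj₁ w) , ≤∧≢⇒< (s≤s⁻¹ (proj₂ w)) (v≢j ∘ toℕ-injective))

        step : Window (d q) q (toℕ v) ⇔ Window (e q) q (toℕ t)
        step = moved (transpose-cases (row b) (col b) v)

  -- The induction invariant. The existential hides `d`, whose relevant values are determined by the
  -- filling and `k`.
  Reached : ℕ → Permutation′ n → Set
  Reached k π = ∃ λ d → Fits n d × DiagonalCounts F k d × Windows d π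

  reached-suc : ∀ {π} r → Reached (toℕ r) π →
                Reached (suc (toℕ r)) (π ∘ₚ transpose (row (boxOf r)) (col (boxOf r)))
  reached-suc {π} r (d , fits , counts , windows) =
    let open NextBox {π = π} r fits counts windows
        e , e-same , e-other = override d p (suc i)
    in e , fits′ e-same e-other , counts′ e-same e-other , windows′ e-same e-other

  -- Since `eval` composes from the head of the list, the transpositions already applied are
  -- accumulated in `π`; the regrouping of the products is definitional on values.
  reached-+ : ∀ m k (f : Fin k → Fin (size n)) → (∀ r → toℕ (f r) ≡ m + toℕ r) → ∀ π → Reached m π →
              Reached (m + k) (π ∘ₚ eval (tabulate λ r → row (boxOf (f r)) , col (boxOf (f r))))
  reached-+ m zero f f≡ π R rewrite +-identityʳ m = R
  -- The first number of the list is `m`; matching replaces `m` by `toℕ (f zero)`, the form that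
  -- `reached-suc` expects.
  reached-+ m (suc k) f f≡ π R with refl ← trans (f≡ zero) (+-identityʳ m) rewrite +-suc (toℕ (f zero)) k =
    reached-+ (suc m) k (f ∘ suc) (λ r → trans (f≡ (suc r)) (+-suc m (toℕ r)))
      (π ∘ₚ transpose (row (boxOf (f zero))) (col (boxOf (f zero)))) (reached-suc {π} (f zero) R)

  reached-zero : Reached 0 idₚ
  reached-zero = (λ _ → 0) , (λ _ _ p≤n → p≤n) , (λ _ _ _ → mk⇔ (λ ()) (λ ())) ,
                 (λ _ _ _ _ → mk⇔ (z≤n ,_) proj₂)

partialFilling-reached : ∀ {n} (T : PartialFilling n) →
  Reached (PartialFilling.filling T) (PartialFilling.k T) (associatedPermutation T)
partialFilling-reached T =
  reached-+ filling 0 k (λ r → inject≤ r k≤size) (λ r → toℕ-inject≤ r k≤size) idₚ (reached-zero filling)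
  where open PartialFilling T

-- The windows of a left-unimodal permutation

-- Pigeonhole: offsets within the two windows turn `σ` into an injection from `Fin l` to `Fin m`.
window-embedding : ∀ {n a b l m} (σ : Permutation′ n) → a + l ≤ n →
                   (∀ x → Window a l (toℕ x) → Window b m (toℕ (σ ⟨$⟩ʳ x))) → l ≤ m
window-embedding {n} {a} {b} {l} {m} σ a+l≤n σ-window = injective⇒≤ {f = f} f-injective
  where
  x : Fin l → Fin n
  x r = fromℕ< {a + toℕ r} (<-≤-trans (+-monoʳ-< a (toℕ<n r)) a+l≤n)
  toℕ-x : ∀ r → toℕ (x r) ≡ a + toℕ r
  toℕ-x r = toℕ-fromℕ< _
  y : Fin l → ℕ
  y r = toℕ (σ ⟨$⟩ʳ x r)
  y-window : ∀ r → Window b m (y r)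
  y-window r = σ-window (x r) (subst (Window a l) (sym (toℕ-x r)) (m≤m+n a (toℕ r) , +-monoʳ-< a (toℕ<n r)))
  y-split : ∀ r → b + (y r ∸ b) ≡ y r
  y-split r = m+[n∸m]≡n (proj₁ (y-window r))
  y∸b<m : ∀ r → y r ∸ b < m
  y∸b<m r = +-cancelˡ-< b _ _ (subst (_< b + m) (sym (y-split r)) (proj₂ (y-window r)))
  f : Fin l → Fin m
  f r = fromℕ< (y∸b<m r)
  f-injective : ∀ {r s} → f r ≡ f s → r ≡ s
  f-injective {r} {s} fr≡fs = toℕ-injective (+-cancelˡ-≡ a _ _
    (trans (sym (toℕ-x r))
           (trans (cong toℕ (trans (sym (inverseˡ σ)) (trans (cong (σ ⟨$⟩ˡ_) σx≡) (inverseˡ σ))))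
                  (toℕ-x s))))
    where
    σx≡ : σ ⟨$⟩ʳ x r ≡ σ ⟨$⟩ʳ x s
    σx≡ = toℕ-injective (trans (sym (y-split r))
            (trans (cong (b +_) (fromℕ<-injective _ _ (y∸b<m r) (y∸b<m s) fr≡fs)) (y-split s)))

-- The bound passed to `ex` is the one found by `≤?`, so that `d` depends on `p` alone; 0 is a
-- default outside the range.
choose : ∀ {n} {Q : ℕ → ℕ → Set} → (∀ p → 0 < p → p ≤ n → ∃ (Q p)) →
         ∃ λ (d : ℕ → ℕ) → ∀ p → 0 < p → p ≤ n → Q p (d p)
choose {n} {Q} ex = d , d-spec
  where
  d : ℕ → ℕ
  d zero    = 0
  d (suc p) with suc p ≤? n
  ... | yes p<n = proj₁ (ex (suc p) z<s p<n)
  ... | no _    = 0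
  d-spec : ∀ p → 0 < p → p ≤ n → Q p (d p)
  d-spec (suc p) _ p<n with suc p ≤? n
  ... | yes p<n′ = proj₂ (ex (suc p) z<s p<n′)
  ... | no p≮n   = contradiction p<n p≮n

module _ {n : ℕ} (π : Permutation′ n) where

  π-injective : ∀ {x y} → toℕ (π ⟨$⟩ʳ x) ≡ toℕ (π ⟨$⟩ʳ y) → x ≡ y
  π-injective πx≡πy =
    trans (sym (inverseˡ π)) (trans (cong (π ⟨$⟩ˡ_) (toℕ-injective πx≡πy)) (inverseˡ π))

  prefix-window : ∀ j → IsInterval (prefix π j) → let p = suc (toℕ j) in
                  ∃ λ a → a + p ≤ n × (∀ x → toℕ x < p ⇔ Window a p (toℕ (π ⟨$⟩ʳ x)))
  prefix-window j (a , b , ⊆ , ⊇)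
    -- The prefix contains the label of `π(j)`, so the interval is nonempty and both its ends are
    -- labels of values taken by `π`.
    with a≤πj , πj≤b ← ⊆ (j , ≤-refl , refl)
    with ⊇ (ℤ.≤-refl , ℤ.≤-trans a≤πj πj≤b) | ⊇ (ℤ.≤-trans a≤πj πj≤b , ℤ.≤-refl)
  ... | i , _ , refl | k , _ , refl =
    lo , subst (λ l → lo + l ≤ n) len≡p (≤-trans (≤-reflexive lo+len≡hi) (toℕ<n (π ⟨$⟩ʳ k))) ,
    λ x → subst (λ l → toℕ x < p ⇔ Window lo l (toℕ (π ⟨$⟩ʳ x))) len≡p (prefix⇔ x)
    where
    p lo hi len : ℕ
    p = suc (toℕ j)
    lo = toℕ (π ⟨$⟩ʳ i)
    hi = suc (toℕ (π ⟨$⟩ʳ k))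
    len = hi ∸ lo
    lo≤hi : lo ≤ hi
    lo≤hi with +≤+ s≤hi ← ℤ.≤-trans a≤πj πj≤b = <⇒≤ s≤hi
    lo+len≡hi : lo + len ≡ hi
    lo+len≡hi = m+[n∸m]≡n lo≤hi
    prefix⇔ : ∀ x → toℕ x < p ⇔ Window lo len (toℕ (π ⟨$⟩ʳ x))
    prefix⇔ x = mk⇔ ⇒ ⇐
      where
      ⇒ : toℕ x < p → Window lo len (toℕ (π ⟨$⟩ʳ x))
      ⇒ x<p with +≤+ lo≤ , +≤+ ≤hi ← ⊆ (x , s≤s⁻¹ x<p , refl) =
        s≤s⁻¹ lo≤ , ≤-trans ≤hi (≤-reflexive (sym lo+len≡hi))
      ⇐ : Window lo len (toℕ (π ⟨$⟩ʳ x)) → toℕ x < p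
      ⇐ (lo≤ , <hi) with y , y≤j , πy≡ ← ⊇ (+≤+ (s≤s lo≤) , +≤+ (≤-trans <hi (≤-reflexive lo+len≡hi))) =
        s≤s (subst (λ z → toℕ z ≤ toℕ j) (π-injective (suc-injective (+-injective πy≡))) y≤j)
    -- The inverse of `π` embeds the window into the first `p` positions, and `π` embeds these into
    -- the window.
    len≡p : len ≡ p
    len≡p = ≤-antisym
      (window-embedding {b = 0} (flip π) (≤-trans (≤-reflexive lo+len≡hi) (toℕ<n (π ⟨$⟩ʳ k)))
        λ x w → z≤n , from (prefix⇔ (π ⟨$⟩ˡ x)) (subst (Window lo len ∘ toℕ) (sym (inverseʳ π)) w))
      (window-embedding {a = 0} π (toℕ<n j) λ x w → to (prefix⇔ x) (proj₂ w))

  leftUnimodal⇒windows : LeftUnimodal n π → ∃ λ d → Fits n d × Windows d π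
  leftUnimodal⇒windows lu =
    let d , spec = choose {n} windowAt
    in d , (λ p 0<p p≤n → proj₁ (spec p 0<p p≤n)) , (λ p 0<p p≤n → proj₂ (spec p 0<p p≤n))
    where
    windowAt : ∀ p → 0 < p → p ≤ n →
               ∃ λ a → a + p ≤ n × (∀ x → toℕ x < p ⇔ Window a p (toℕ (π ⟨$⟩ʳ x)))
    windowAt (suc p) _ p<n =
      subst (λ m → ∃ λ a → a + suc m ≤ n × (∀ x → toℕ x < suc m ⇔ Window a (suc m) (toℕ (π ⟨$⟩ʳ x))))
            (toℕ-fromℕ< p<n) (prefix-window (fromℕ< p<n) (lu (fromℕ< p<n)))

  -- The first `p` positions are among the first `q`, so one window lies in the other; its least and
  -- greatest values give the two inequalities. Matching `p` as a successor names the greatest value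
  -- without subtraction.
  windows-nested : ∀ {d} → Fits n d → Windows d π →
                   ∀ {p q} → 0 < p → p ≤ q → q ≤ n → d q ≤ d p × d p + p ≤ d q + q
  windows-nested {d} fits W {suc p} {q} 0<p p≤q q≤n =
    proj₁ (enlarge (d (suc p)) (≤-refl , m<m+n _ 0<p)) ,
    subst (_≤ d q + q) (sym (+-suc _ p))
      (proj₂ (enlarge (d (suc p) + p) (m≤m+n _ p , ≤-reflexive (sym (+-suc _ p)))))
    where
    enlarge : ∀ v → Window (d (suc p)) (suc p) v → Window (d q) q v
    enlarge v w = subst (Window (d q) q) πx≡v
      (to (W q (<-≤-trans 0<p p≤q) q≤n x)
        (<-≤-trans (from (W (suc p) 0<p (≤-trans p≤q q≤n) x) (subst (Window _ _) (sym πx≡v) w)) p≤q))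
      where
      v<n : v < n
      v<n = <-≤-trans (proj₂ w) (fits (suc p) 0<p (≤-trans p≤q q≤n))
      x : Fin n
      x = π ⟨$⟩ˡ fromℕ< v<n
      πx≡v : toℕ (π ⟨$⟩ʳ x) ≡ v
      πx≡v = trans (cong toℕ (inverseʳ π)) (toℕ-fromℕ< v<n)

-- Fillings from sorted lists of boxes

boxes : ∀ n → List (Box n)
boxes zero    = []
boxes (suc n) = tabulate (λ j → box zero (suc j) z<s) ++
                map (λ (box i j i<j) → box (suc i) (suc j) (s≤s i<j)) (boxes n)

∈-boxes : ∀ {n} (b : Box n) → b ∈ boxes n
∈-boxes (box zero    zero    ())
∈-boxes (box (suc i) zero    ())
∈-boxes (box zero    (suc j) _)   = ∈-++⁺ˡ (∈-tabulate⁺ j)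
∈-boxes (box (suc i) (suc j) i<j) = ∈-++⁺ʳ _ (∈-map⁺ _ (∈-boxes (box i j (s≤s⁻¹ i<j))))

length-boxes : ∀ n → length (boxes n) ≡ size n
length-boxes zero    = refl
length-boxes (suc n) = begin
  length (boxes (suc n))      ≡⟨ length-++ (tabulate {n = n} _) ⟩
  length (tabulate {n = n} _) + length (map _ (boxes n))
    ≡⟨ cong₂ _+_ (length-tabulate {n = n} _) (trans (length-map _ (boxes n)) (length-boxes n)) ⟩
  -- Writing `n` as `n * 2 / 2` lets the quotients be added, as the first numerator is divisible by
  -- 2.
  n + size n                  ≡⟨ cong (_+ size n) (m*n/n≡m n 2) ⟨
  n * 2 / 2 + size n          ≡⟨ +-distrib-/-∣ˡ (n * (n ∸ 1)) (divides-refl n) ⟨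
  (n * 2 + n * (n ∸ 1)) / 2   ≡⟨ cong (_/ 2) (double n) ⟩
  size (suc n)                ∎
  where
  open ≡-Reasoning
  double : ∀ n → n * 2 + n * (n ∸ 1) ≡ suc n * n
  -- The case split removes the truncated subtraction, so that the ring solver applies.
  double zero    = refl
  double (suc n) = solve 1 (λ n → (con 1 :+ n) :* con 2 :+ (con 1 :+ n) :* n
                               := (con 2 :+ n) :* (con 1 :+ n)) refl n
    where open +-*-Solver

-- Fillings are the linear extensions of this order.
_≼_ : ∀ {n} → Rel (Box n) _
c ≼ b = row c Fin.≤ row b × col c Fin.≤ col b

-- A later box is further right in the same row, or in a lower row. As `≼` is reflexive, this
-- negative form also excludes repetitions.
boxes-sorted : ∀ n → AllPairs (λ b c → ¬ c ≼ b) (boxes n)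
boxes-sorted zero    = []
boxes-sorted (suc n) = AllPairs.++⁺
  (AllPairs.tabulate⁺-< λ i<j c≼b → <⇒≱ i<j (s≤s⁻¹ (proj₂ c≼b)))
  (AllPairs.map⁺ (AllPairs.map (λ c⋠b c≼b → c⋠b (s≤s⁻¹ (proj₁ c≼b) , s≤s⁻¹ (proj₂ c≼b)))
                               (boxes-sorted n)))
  (All.tabulate⁺ λ _ → All.map⁺ (All.universal (λ _ ()) (boxes n)))

AllPairs-lookup : ∀ {a ℓ} {A : Set a} {R : Rel A ℓ} {xs} → AllPairs R xs →
                  ∀ {i j} → i Fin.< j → R (lookup xs i) (lookup xs j)
AllPairs-lookup (px ∷ _)   {zero}  {suc j} _   = All.lookup px (∈-lookup j)
AllPairs-lookup (_ ∷ pxs) {suc i} {suc j} i<j = AllPairs-lookup pxs (s≤s⁻¹ i<j)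

lookup-++-< : ∀ {a} {A : Set a} (xs {ys} : List A) i → toℕ i < length xs → lookup (xs ++ ys) i ∈ xs
lookup-++-< (x ∷ xs) zero    _   = here refl
lookup-++-< (x ∷ xs) (suc i) i<l = there (lookup-++-< xs i (s≤s⁻¹ i<l))

lookup-++-≥ : ∀ {a} {A : Set a} (xs {ys} : List A) i → length xs ≤ toℕ i → lookup (xs ++ ys) i ∈ ys
lookup-++-≥ []       i       _   = ∈-lookup i
lookup-++-≥ (x ∷ xs) (suc i) l≤i = lookup-++-≥ xs i (s≤s⁻¹ l≤i)

module _ {n : ℕ} (bs : List (Box n)) (complete : ∀ b → b ∈ bs) (length≡ : length bs ≡ size n)
         (sorted : AllPairs (λ b c → ¬ c ≼ b) bs) where

  private
    position : Box n → Fin (size n)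
    position b = cast length≡ (index (complete b))

    boxAt : Fin (size n) → Box n
    boxAt r = lookup bs (cast (sym length≡) r)

    boxAt-position : ∀ b → boxAt (position b) ≡ b
    boxAt-position b = trans (cong (lookup bs) (cast-involutive (sym length≡) length≡ _)) (sym (lookup-index (complete b)))

    boxAt-sorted : ∀ {r s} → r Fin.< s → ¬ boxAt s ≼ boxAt r
    boxAt-sorted {r} {s} r<s = AllPairs-lookup sorted
      (subst₂ _<_ (sym (toℕ-cast (sym length≡) r)) (sym (toℕ-cast (sym length≡) s)) r<s)

    ≼-reflexive : ∀ {b c : Box n} → b ≡ c → b ≼ c
    ≼-reflexive refl = ≤-refl , ≤-refl

    -- Otherwise one box would occur at two places of the list, which sortedness excludes.
    position-boxAt : ∀ r → position (boxAt r) ≡ r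
    position-boxAt r with Fin.<-cmp (position (boxAt r)) r
    ... | tri< s<r _ _ = contradiction (≼-reflexive (sym (boxAt-position (boxAt r)))) (boxAt-sorted s<r)
    ... | tri≈ _ s≡r _ = s≡r
    ... | tri> _ _ r<s = contradiction (≼-reflexive (boxAt-position (boxAt r))) (boxAt-sorted r<s)

    position-monotone : ∀ {b c} → b ≼ c → b ≢ c → position b Fin.< position c
    position-monotone {b} {c} b≼c b≢c with Fin.<-cmp (position b) (position c)
    ... | tri< r<s _ _ = r<s
    ... | tri≈ _ r≡s _ =
      contradiction (trans (sym (boxAt-position b)) (trans (cong boxAt r≡s) (boxAt-position c))) b≢c
    ... | tri> _ _ s<r =
      contradiction (subst₂ _≼_ (sym (boxAt-position b)) (sym (boxAt-position c)) b≼c) (boxAt-sorted s<r)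

  listFilling : Filling n
  listFilling = record
    { entries            = mk↔ₛ′ position boxAt position-boxAt boxAt-position
    ; rows-increasing    = λ b c rb≡rc cb<cc → position-monotone (≤-reflexive (cong toℕ rb≡rc) , <⇒≤ cb<cc)
                             λ b≡c → <-irrefl (cong (toℕ ∘ col) b≡c) cb<cc
    ; columns-increasing = λ b c cb≡cc rb<rc → position-monotone (<⇒≤ rb<rc , ≤-reflexive (cong toℕ cb≡cc))
                             λ b≡c → <-irrefl (cong (toℕ ∘ row) b≡c) rb<rc
    }

-- Partial fillings from down-closed sets of boxes

module _ {n ℓ} {P : Pred (Box n) ℓ} (P? : Decidable P) (down : ∀ {b c} → c ≼ b → P b → P c) where

  private
    inside outside bs : List (Box n)
    inside = filter P? (boxes n)
    outside = filter (∁? P?) (boxes n)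
    bs = inside ++ outside

    complete : ∀ b → b ∈ bs
    complete b with P? b
    ... | yes Pb = ∈-++⁺ˡ (∈-filter⁺ P? (∈-boxes b) Pb)
    ... | no ¬Pb = ∈-++⁺ʳ inside (∈-filter⁺ (∁? P?) (∈-boxes b) ¬Pb)

    length≡ : length bs ≡ size n
    -- The two filters are the halves of `partition`, whose concatenation permutes the list.
    length≡ = trans (sym (xs↭ys⇒|xs|≡|ys| (subst (λ (xs , ys) → Permutation (boxes n) (xs ++ ys))
                                                 (partition-defn P? (boxes n)) (partition-↭ P? (boxes n)))))
                    (length-boxes n)
      where
      open SetoidPermutation (setoid (Box n))
      open import Data.List.Relation.Binary.Permutation.Setoid (setoid (Box n))
        using () renaming (_↭_ to Permutation)

    sorted : AllPairs (λ b c → ¬ c ≼ b) bs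
    sorted = AllPairs.++⁺ (AllPairs.filter⁺ P? (boxes-sorted n)) (AllPairs.filter⁺ (∁? P?) (boxes-sorted n))
      -- Across the two halves, an outside box below an inside one in `≼` would satisfy `P` by
      -- `down`.
      (All.map (λ Pb → All.map (λ ¬Pc c≼b → ¬Pc (down c≼b Pb)) (All.all-filter (∁? P?) (boxes n)))
               (All.all-filter P? (boxes n)))

    F : Filling n
    F = listFilling bs complete length≡ sorted

    entry⇔ : ∀ b → toℕ (Filling.entry F b) < length inside ⇔ P b
    entry⇔ b = mk⇔ ⇒ λ Pb → ≰⇒> λ l≤ → ⇐ l≤ Pb
      where
      i = index (complete b)
      ⇒ : toℕ (Filling.entry F b) < length inside → P b
      ⇒ <l = subst P (sym (lookup-index (complete b)))
        (All.lookup (All.all-filter P? (boxes n))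
                    (lookup-++-< inside i (subst (_< length inside) (toℕ-cast length≡ i) <l)))
      ⇐ : length inside ≤ toℕ (Filling.entry F b) → ¬ P b
      ⇐ l≤ = subst (∁ P) (sym (lookup-index (complete b)))
        (All.lookup (All.all-filter (∁? P?) (boxes n))
                    (lookup-++-≥ inside i (subst (length inside ≤_) (toℕ-cast length≡ i) l≤)))

  downSet-partialFilling : ∃ λ (T : PartialFilling n) →
    ∀ b → toℕ (Filling.entry (PartialFilling.filling T) b) < PartialFilling.k T ⇔ P b
  downSet-partialFilling =
    record { filling = F ; k = length inside
           ; k≤size = ≤-trans (length-++-≤ˡ inside) (≤-reflexive length≡) } , entry⇔

-- The two inclusions

leftUnimodal⇒fromPartialFilling : ∀ {n} (π : Permutation′ n) → LeftUnimodal n π → FromPartialFilling n π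
leftUnimodal⇒fromPartialFilling {n} π lu =
  let d , fits , W = leftUnimodal⇒windows π lu
      -- With rows counted from 0, the condition `i ≤ d (j − i)` becomes strict.
      T , T⇔ = downSet-partialFilling (λ b → toℕ (row b) <? d (toℕ (col b) ∸ toℕ (row b)))
                                      (λ {b c} → down {d} fits W {b} {c})
      open PartialFilling T
      counts = λ b p diag → subst (λ q → toℕ (Filling.entry filling b) < k ⇔ toℕ (row b) < d q)
                 (trans (cong (_∸ toℕ (row b)) (sym diag)) (m+n∸m≡n (toℕ (row b)) p)) (T⇔ b)
      e , fitsₑ , countsₑ , V = partialFilling-reached T
  -- Both `d` and `e` count the boxes of `T`, so they agree, and equal windows give equal
  -- permutations.
  in T , windows-determine {d = e} {d} (associatedPermutation T) π V W λ p 0<p p≤n →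
       ≤-antisym (diagonalCounts-≤ filling k {e} {d} fitsₑ countsₑ counts p 0<p p≤n)
                 (diagonalCounts-≤ filling k {d} {e} fits counts countsₑ p 0<p p≤n)
  where
  -- Go from `b` up its column, then left along the row of `c`. Going up lengthens the window, whose
  -- upper end cannot fall; going left shortens it, and its lower end cannot fall.
  down : ∀ {d} → Fits n d → Windows d π → ∀ {b c} → c ≼ b →
         toℕ (row b) < d (toℕ (col b) ∸ toℕ (row b)) → toℕ (row c) < d (toℕ (col c) ∸ toℕ (row c))
  down {d} fits W {b} {c} (rc≤rb , cc≤cb) rb<d =
    <-≤-trans rc<d (proj₁ (windows-nested π {d} fits W (m<n⇒0<n∸m (row<col c)) (∸-monoˡ-≤ rc cc≤cb) (diag≤n b rc)))
    where
    rb = toℕ (row b)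
    rc = toℕ (row c)
    cb = toℕ (col b)
    diag≤n : ∀ b i → toℕ (col b) ∸ i ≤ n
    diag≤n b i = ≤-trans (m∸n≤m _ i) (<⇒≤ (toℕ<n (col b)))
    rc≤cb : rc ≤ cb
    rc≤cb = ≤-trans rc≤rb (<⇒≤ (row<col b))
    rc<d : rc < d (cb ∸ rc)
    rc<d = +-cancelʳ-< (cb ∸ rc) rc (d (cb ∸ rc)) (begin-strict
      rc + (cb ∸ rc)            ≡⟨ m+[n∸m]≡n rc≤cb ⟩
      cb                        ≡⟨ m+[n∸m]≡n (<⇒≤ (row<col b)) ⟨
      rb + (cb ∸ rb)            <⟨ +-monoˡ-< (cb ∸ rb) rb<d ⟩
      d (cb ∸ rb) + (cb ∸ rb)
        ≤⟨ proj₂ (windows-nested π {d} fits W (m<n⇒0<n∸m (row<col b)) (∸-monoʳ-≤ cb rc≤rb)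
                                 (diag≤n b rc)) ⟩
      d (cb ∸ rc) + (cb ∸ rc)   ∎)
      where open ≤-Reasoning

fromPartialFilling⇒leftUnimodal : ∀ {n} (π : Permutation′ n) → FromPartialFilling n π → LeftUnimodal n π
fromPartialFilling⇒leftUnimodal π (T , T≈π) =
  let d , fits , _ , W = partialFilling-reached T
  in windows⇒leftUnimodal {d = d} π fits λ p 0<p p≤n x →
       subst (λ v → toℕ x < p ⇔ Window (d p) p (toℕ v)) (T≈π x) (W p 0<p p≤n x)

theorem4p1 : (n : ℕ) → FromPartialFilling n ≐ LeftUnimodal n
theorem4p1 n = (λ {π} → fromPartialFilling⇒leftUnimodal π) , (λ {π} → leftUnimodal⇒fromPartialFilling π)
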